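{- Let $(a,b)$ be a pair of coprime positive integers and let $n\ge 1$. Then $\Delta_{\mathrm{Dyck}_n}^{(a,b)}$ is a shellable simplicial complex. In particular, $\Delta_{\mathrm{Dyck}_n}=\Delta_{\mathrm{Dyck}_n}^{(1,1)}$ (which is isomorphic to $\Delta_{A_n}$ in the paper's notation) is a shellable simplicial complex.
   Context: For a word $w=w_1\cdots w_r$ in the alphabet $\{U,D\}$ and $0\le i\le r$ let $|U_i(w)|$ and $|D_i(w)|$ be the numbers of letters $U$ and $D$, respectively, among $w_1,\ldots,w_i$. For coprime positive integers $a,b$, the word $w$ is an $(a,b)$-Dyck path if $b\,|D_i(w)|\le a\,|U_i(w)|$ for $1\le i<r$ and $b\,|D_r(w)|=a\,|U_r(w)|$. Then $|U_r(w)|=nb$, $|D_r(w)|=na$ and $r=n(a+b)$ for an integer $n$, called the $(a,b)$-semilength of $w$. Let $\mathrm{Dyck}_n^{(a,b)}$ be the set of all $(a,b)$-Dyck paths of $(a,b)$-semilength $n$. A valley of $w$ is an index $1\le i<r$ with $w_i=D$, $w_{i+1}=U$; it is identified with its position $(i,\,|U_i(w)|-|D_i(w)|)\in\mathbb{Z}\times\mathbb{Z}$. Let $V(w)$ be the set of positions of all valleys of $w$ and set $\Delta_{\mathrm{Dyck}_n}^{(a,b)}=\{V(w) : w\in\mathrm{Dyck}_n^{(a,b)}\}$. A finite simplicial complex $\Delta$ (not necessarily pure) is shellable if there is a linear order $\prec$ on the set of its maximal (by inclusion) faces such that whenever $\sigma\prec\tau$ are maximal faces there is a maximal face $\gamma\prec\tau$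 with $\sigma\cap\tau\subseteq\gamma\cap\tau=\tau\setminus\{x\}$ for some $x\in\tau$. Regarding the parenthetical identification: $\Delta_{A_m}$ denotes the complex of antichains in the root poset of type $A_m$, i.e. in $\{e_i-e_j : 1\le i<j\le m+1\}$ ordered by $e_i-e_j\le e_{i'}-e_{j'}$ iff $i'\le i<j\le j'$; antichains in this poset correspond bijectively to classical Dyck paths of semilength $m+1$.
   Formalization: The parenthetical isomorphism is stated with Δ_{A_{n-1}} in place of Δ_{A_n}: with Δ_{A_m} the antichain complex of the root poset of type A_m, the index n fails (for n=1, Δ_{Dyck_1}={∅} but Δ_{A_1} has a vertex). -}

module Defs where

open import Level using (0ℓ)
open import Data.Nat using (ℕ; suc; _+_; _*_; _≤_; _<_)
open import Data.Integer using (ℤ; +_; _-_)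
open import Data.Fin as Fin using (Fin)
open import Data.List using (List; []; _∷_; [_]; length; take; drop; head; filter; map)
open import Data.List.Membership.Propositional using () renaming (_∈_ to _∈ˡ_)
open import Data.List.Relation.Unary.Any using (Any)
open import Data.Maybe using (Maybe; just; nothing)
open import Data.Product using (Σ; Σ-syntax; ∃; ∃-syntax; _×_; _,_; proj₁; proj₂)
open import Function.Base using (_∘_; _on_)
open import Function.Bundles using (_⇔_; Inverse)
open import Relation.Binary.Bundles using (Setoid)
open import Relation.Binary.Core using (Rel)
open import Relation.Binary.Definitions using (DecidableEquality)
open import Relation.Binary.Structures using (IsStrictTotalOrder)
open import Relation.Binary.PropositionalEquality using (_≡_; refl; setoid)
import Relation.Binary.Construct.On as On
open import Relation.Nullary using (yes; no)
open import Relation.Unary using (Pred; _∈_; _⊆_; _≐_; _∩_; _∖_; ｛_｝)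

-- A finite set is given by a list enumerating its elements; order and
-- repetitions are irrelevant, so lists are only ever compared through ⟦_⟧.

⟦_⟧ : {V : Set} → List V → Pred V 0ℓ
⟦ σ ⟧ = λ v → v ∈ˡ σ

infix 4 _≋_
_≋_ : {V : Set} → Rel (List V) 0ℓ
σ ≋ τ = ⟦ σ ⟧ ≐ ⟦ τ ⟧

Family : Set → Set₁
Family V = Pred (List V) 0ℓ

-- Invariance of Δ under _≋_ is a consequence of down-closed.

record IsFiniteSimplicialComplex {V : Set} (Δ : Family V) : Set where
  field
    empty-face  : [] ∈ Δ
    down-closed : ∀ {σ τ} → τ ∈ Δ → ⟦ σ ⟧ ⊆ ⟦ τ ⟧ → σ ∈ Δ
    finite      : ∃[ faces ] (∀ σ → σ ∈ Δ ⇔ Any (σ ≋_) faces)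

IsFacet : {V : Set} → Family V → Pred (List V) 0ℓ
IsFacet Δ σ = σ ∈ Δ × (∀ τ → τ ∈ Δ → ⟦ σ ⟧ ⊆ ⟦ τ ⟧ → σ ≋ τ)

Facet : {V : Set} → Family V → Set
Facet Δ = ∃ (IsFacet Δ)

IsShelling : {V : Set} (Δ : Family V) → Rel (Facet Δ) 0ℓ → Set
IsShelling {V} Δ _≺_ =
  ∀ (σ τ : Facet Δ) → σ ≺ τ →
  Σ[ γ ∈ Facet Δ ] γ ≺ τ × Σ[ x ∈ V ] x ∈ set τ ×
    (set σ ∩ set τ) ⊆ (set γ ∩ set τ) ×
    (set γ ∩ set τ) ≐ (set τ ∖ ｛ x ｝)
  where
  set : Facet Δ → Pred V 0ℓ
  set φ = ⟦ proj₁ φ ⟧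

Shellable : {V : Set} → Family V → Set₁
Shellable Δ =
  ∃ λ (_≺_ : Rel (Facet Δ) 0ℓ) →
    IsStrictTotalOrder (_≋_ on proj₁) _≺_ × IsShelling Δ _≺_

-- The vertices are those v for which {v} is a face, compared by v alone.

vertices : {V : Set} → Family V → Setoid 0ℓ 0ℓ
vertices {V} Δ = On.setoid {B = Σ[ v ∈ V ] [ v ] ∈ Δ} (setoid V) proj₁

record _≅_ {V W : Set} (Δ : Family V) (Γ : Family W) : Set where
  field
    vertex-bijection : Inverse (vertices Δ) (vertices Γ)
  open Inverse vertex-bijection using (to)
  field
    preserves-faces : ∀ (σ : List (Setoid.Carrier (vertices Δ))) →
      map proj₁ σ ∈ Δ ⇔ map (proj₁ ∘ to) σ ∈ Γ

data Letter : Set where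
  U D : Letter

_≟_ : DecidableEquality Letter
U ≟ U = yes refl
U ≟ D = no λ ()
D ≟ U = no λ ()
D ≟ D = yes refl

Word : Set
Word = List Letter

-- count ℓ i w is the number of letters ℓ among w₁,…,wᵢ.

count : Letter → ℕ → Word → ℕ
count ℓ i w = length (filter (ℓ ≟_) (take i w))

-- Letters are numbered from 1.

_at_ : Word → ℕ → Maybe Letter
w at 0     = nothing
w at suc i = head (drop i w)

IsDyckPath : ℕ → ℕ → Pred Word 0ℓ
IsDyckPath a b w =
  (∀ i → 1 ≤ i → i < length w → b * count D i w ≤ a * count U i w) ×
  b * count D (length w) w ≡ a * count U (length w) w

HasSemilength : ℕ → ℕ → ℕ → Pred Word 0ℓ
HasSemilength a b n w =
  count U (length w) w ≡ n * b ×
  count D (length w) w ≡ n * a ×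
  length w ≡ n * (a + b)

Dyck : ℕ → ℕ → ℕ → Pred Word 0ℓ
Dyck a b n w = IsDyckPath a b w × HasSemilength a b n w

Position : Set
Position = ℤ × ℤ

IsValley : Word → Pred ℕ 0ℓ
IsValley w i = 1 ≤ i × i < length w × w at i ≡ just D × w at suc i ≡ just U

position : Word → ℕ → Position
position w i = + i , + count U i w - + count D i w

valleys : Word → Pred Position 0ℓ
valleys w p = ∃[ i ] i ∈ IsValley w × p ≡ position w i

ΔDyck : ℕ → ℕ → ℕ → Family Position
ΔDyck a b n σ = ∃[ w ] w ∈ Dyck a b n × ⟦ σ ⟧ ≐ valleys w

-- The pair (i , j) with i < j stands for the positive root eᵢ − eⱼ of type A_m;
-- the m + 1 indices are numbered from 0.

Root : ℕ → Set
Root m = Σ[ (i , j) ∈ Fin (suc m) × Fin (suc m) ] i Fin.< j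

_⊑_ : {m : ℕ} → Rel (Root m) 0ℓ
((i , j) , _) ⊑ ((i′ , j′) , _) = i′ Fin.≤ i × j Fin.≤ j′

ΔA : (m : ℕ) → Family (Root m)
ΔA m σ = ∀ {α β} → α ∈ ⟦ σ ⟧ → β ∈ ⟦ σ ⟧ → α ⊑ β → α ≡ β

{-# OPTIONS --safe #-}

-- In the coordinates (x , y) = (number of U's, number of D's), a set of positions is the
-- valley set of a Dyck path exactly when it is a chain, for the order "strictly smaller in
-- both coordinates", in the region 1 ≤ y, b y ≤ a x, x < n b.  This region is closed under
-- componentwise minima, and chains in a finite set of points closed under minima are
-- shelled by comparing facets lexicographically: if τ is later than σ, p is the first
-- element where they differ and t the next element of τ after p, exchange t for c = p ∧ t
-- and extend to a facet γ.  Everything below t in τ lies below c, everything above t lies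
-- above c, so γ keeps τ ∖ {t}, and γ is earlier than τ because c is lexicographically
-- smaller than t.

module Submission where

open import Defs
open import Level using (0ℓ)
open import Data.Fin using (toℕ; fromℕ<)
import Data.Fin.Properties as Fin
open import Data.Integer as ℤ using (+_; ∣_∣)
import Data.Integer.Properties as ℤ
open import Data.Integer.Tactic.RingSolver using (solve-∀)
open import Data.List
  using (List; []; _∷_; [_]; _++_; applyUpTo; cartesianProduct; filter; length; map; upTo)
import Data.List.Membership.DecPropositional as DecMembership
open import Data.List.Membership.Propositional using (_∈_; _∉_; find; lose)
open import Data.List.Membership.Propositional.Properties
  using (∈-map⁺; ∈-map⁻; ∈-++⁺ˡ; ∈-++⁺ʳ; ∈-filter⁺; ∈-filter⁻; ∈-cartesianProduct⁺; ∈-upTo⁺)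
open import Data.List.Properties using (length-applyUpTo)
import Data.List.Relation.Unary.All as All
open import Data.List.Relation.Unary.Any using (Any; here; there; any?)
open import Data.Maybe using (just)
open import Data.Maybe.Properties using (just-injective)
open import Data.Nat
  using (ℕ; zero; suc; _+_; _*_; _∸_; _⊓_; ⌊_/2⌋; _≤_; _<_; z≤n; s≤s)
open import Data.Nat.Coprimality using (Coprime)
import Data.Nat.Properties as ℕ
open import Data.Product using (Σ-syntax; ∃-syntax; _×_; _,_; proj₁; proj₂)
open import Data.Product.Properties using (≡-dec)
open import Data.Product.Relation.Binary.Lex.Strict using (×-Lex; ×-isStrictTotalOrder)
open import Data.Sum using (_⊎_; inj₁; inj₂; [_,_]′)
open import Function.Base using (_∘_; _on_; id)
open import Function.Bundles using (_⇔_; Equivalence; mk⇔)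
open import Relation.Binary.Bundles using (Setoid)
open import Relation.Binary.Core using (Rel)
open import Relation.Binary.Definitions using (DecidableEquality; Tri; tri<; tri≈; tri>)
open import Relation.Binary.PropositionalEquality
  using (_≡_; _≢_; refl; sym; trans; cong; cong₂; subst; subst₂; module ≡-Reasoning)
open import Relation.Binary.Structures using (IsStrictTotalOrder)
open import Relation.Nullary using (Dec; yes; no; ¬_; ¬?; contradiction)
open import Relation.Nullary.Decidable using (_×-dec_; _⊎-dec_; map′)
open import Relation.Unary using (Pred; Decidable; _⊆_)

-- Lattice points, their strict product order and the lexicographic order.

Point : Set
Point = ℕ × ℕ

infix 4 _≪_ _<ₗ_
infixl 7 _∧_

_≪_ : Rel Point 0ℓ
(x , y) ≪ (x′ , y′) = x < x′ × y < y′

_∧_ : Point → Point → Point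
(x , y) ∧ (x′ , y′) = x ⊓ x′ , y ⊓ y′

≪-irrefl : ∀ {p} → ¬ p ≪ p
≪-irrefl = ℕ.<-irrefl refl ∘ proj₁

≪-glb : ∀ {p q r} → p ≪ q → p ≪ r → p ≪ q ∧ r
≪-glb (a , b) (c , d) = ℕ.⊓-glb a c , ℕ.⊓-glb b d

∧-≪ : ∀ {p q r} → q ≪ r → p ∧ q ≪ r
∧-≪ (a , b) = ℕ.≤-<-trans (ℕ.m⊓n≤n _ _) a , ℕ.≤-<-trans (ℕ.m⊓n≤n _ _) b

≪-∧ : ∀ {p q r} → p ≪ q ∧ r → p ≪ r
≪-∧ (a , b) = ℕ.<-≤-trans a (ℕ.m⊓n≤n _ _) , ℕ.<-≤-trans b (ℕ.m⊓n≤n _ _)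

Comparable : Rel Point 0ℓ
Comparable p q = p ≡ q ⊎ p ≪ q ⊎ q ≪ p

Comparable-sym : ∀ {p q} → Comparable p q → Comparable q p
Comparable-sym (inj₁ p≡q)        = inj₁ (sym p≡q)
Comparable-sym (inj₂ (inj₁ p≪q)) = inj₂ (inj₂ p≪q)
Comparable-sym (inj₂ (inj₂ q≪p)) = inj₂ (inj₁ q≪p)

comparable? : ∀ p q → Dec (Comparable p q)
comparable? p@(x , y) q@(x′ , y′) =
  map′ (λ (e , f) → cong₂ _,_ e f) (λ e → cong proj₁ e , cong proj₂ e) (x ℕ.≟ x′ ×-dec y ℕ.≟ y′)
  ⊎-dec (x ℕ.<? x′ ×-dec y ℕ.<? y′)
  ⊎-dec (x′ ℕ.<? x ×-dec y′ ℕ.<? y)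

_<ₗ_ : Rel Point 0ℓ
_<ₗ_ = ×-Lex _≡_ _<_ _<_

module Lex = IsStrictTotalOrder
  (×-isStrictTotalOrder ℕ.<-isStrictTotalOrder ℕ.<-isStrictTotalOrder)

≪⇒<ₗ : ∀ {p q} → p ≪ q → p <ₗ q
≪⇒<ₗ = inj₁ ∘ proj₁

-- The meet is at most `p` in both coordinates, hence lexicographically at most `p`. This is what
-- makes the exchanged point earlier than the one it replaces.
∧-<ₗ : ∀ {p q} → p <ₗ q → p ∧ q <ₗ q
∧-<ₗ (inj₁ x<x′)          = inj₁ (ℕ.≤-<-trans (ℕ.m⊓n≤m _ _) x<x′)
∧-<ₗ (inj₂ (refl , y<y′)) = inj₂ (ℕ.⊓-idem _ , ℕ.≤-<-trans (ℕ.m⊓n≤m _ _) y<y′)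

-- Within a chain the lexicographic order is just `≪`, so sorting the elements of a facet yields
-- strict inequalities in both coordinates.
comparable∧<ₗ⇒≪ : ∀ {p q} → Comparable p q → p <ₗ q → p ≪ q
comparable∧<ₗ⇒≪ (inj₁ refl)       p<p = contradiction p<p (Lex.irrefl (refl , refl))
comparable∧<ₗ⇒≪ (inj₂ (inj₁ p≪q)) _   = p≪q
comparable∧<ₗ⇒≪ {p} {q} (inj₂ (inj₂ q≪p)) p<q =
  contradiction (≪⇒<ₗ q≪p) (Lex.asym {p} {q} p<q)

-- Lists as finite sets.

sublists : {A : Set} → List A → List (List A)
sublists []       = [] ∷ []
sublists (x ∷ xs) = map (x ∷_) (sublists xs) ++ sublists xs

filter∈sublists : ∀ {A : Set} {Q : Pred A 0ℓ} (Q? : Decidable Q) xs → filter Q? xs ∈ sublists xs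
filter∈sublists Q? []       = here refl
filter∈sublists Q? (x ∷ xs) with Q? x
... | yes _ = ∈-++⁺ˡ (∈-map⁺ (x ∷_) (filter∈sublists Q? xs))
... | no  _ = ∈-++⁺ʳ (map (x ∷_) (sublists xs)) (filter∈sublists Q? xs)

≋-refl : {V : Set} {σ : List V} → σ ≋ σ
≋-refl = id , id

≋-sym : {V : Set} {σ τ : List V} → σ ≋ τ → τ ≋ σ
≋-sym (f , g) = g , f

≋-trans : {V : Set} {σ τ υ : List V} → σ ≋ τ → τ ≋ υ → σ ≋ υ
≋-trans (f , g) (h , k) = h ∘ f , g ∘ k

-- Shelling of complexes of chains in a finite set of points closed under meets.

IsChain : {V : Set} → (V → Point) → List V → Pred (List V) 0ℓ
IsChain coord points σ =
  ⟦ σ ⟧ ⊆ ⟦ points ⟧ × (∀ {p q} → p ∈ σ → q ∈ σ → Comparable (coord p) (coord q))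

-- Vertices are kept apart from their coordinates because the vertices of `ΔDyck` are integer
-- positions, on which the coordinate map is injective only after restriction to `points`.
module ChainComplex
  {V : Set} (_≟ⱽ_ : DecidableEquality V) (coord : V → Point) (points : List V)
  (coord-injective : ∀ {p q} → p ∈ points → q ∈ points → coord p ≡ coord q → p ≡ q)
  (meet : ∀ {p q} → p ∈ points → q ∈ points → ∃[ c ] c ∈ points × coord c ≡ coord p ∧ coord q)
  (Δ : Family V) (Δ⇔chain : ∀ σ → Δ σ ⇔ IsChain coord points σ)
  where

  open DecMembership _≟ⱽ_ using (_∈?_)

  Chain : Pred (List V) 0ℓ
  Chain = IsChain coord points

  _◁_ : Rel V 0ℓ
  _◁_ = _<ₗ_ on coord

  ◁-irrefl : ∀ {p q} → p ≡ q → ¬ p ◁ q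
  ◁-irrefl refl = Lex.irrefl (refl , refl)

  ◁-asym : ∀ {p q} → p ◁ q → ¬ q ◁ p
  ◁-asym {p} {q} = Lex.asym {coord p} {coord q}

  ◁-trans : ∀ {p q r} → p ◁ q → q ◁ r → p ◁ r
  ◁-trans {p} {q} {r} = Lex.trans {coord p} {coord q} {coord r}

  _◁?_ : ∀ p q → Dec (p ◁ q)
  p ◁? q = coord p Lex.<? coord q

  ◁-compare : ∀ {p q} → p ∈ points → q ∈ points → p ◁ q ⊎ p ≡ q ⊎ q ◁ p
  ◁-compare {p} {q} p∈ q∈ with Lex.compare (coord p) (coord q)
  ... | tri< p◁q _ _       = inj₁ p◁q
  ... | tri≈ _ (ex , ey) _ = inj₂ (inj₁ (coord-injective p∈ q∈ (cong₂ _,_ ex ey)))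
  ... | tri> _ _ q◁p       = inj₂ (inj₂ q◁p)

  chain? : Decidable Chain
  chain? σ =
    map′ (λ a → All.lookup a) (λ s → All.tabulate s) (All.all? (_∈? points) σ)
    ×-dec
    map′ (λ a {p} {q} p∈ q∈ → All.lookup (All.lookup a p∈) q∈)
         (λ c → All.tabulate (λ p∈ → All.tabulate (λ q∈ → c p∈ q∈)))
         (All.all? (λ p → All.all? (λ q → comparable? (coord p) (coord q)) σ) σ)

  chain-⊆ : ∀ {σ τ} → Chain τ → ⟦ σ ⟧ ⊆ ⟦ τ ⟧ → Chain σ
  chain-⊆ (τ⊆ , cmp) σ⊆τ = τ⊆ ∘ σ⊆τ , λ p∈ q∈ → cmp (σ⊆τ p∈) (σ⊆τ q∈)

  chain-∷ : ∀ {c σ} → c ∈ points → Chain σ → (∀ {q} → q ∈ σ → Comparable (coord c) (coord q)) →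
    Chain (c ∷ σ)
  chain-∷ {c} {σ} c∈ (σ⊆ , cmp) c~σ = ⊆points , comparable
    where
    ⊆points : ⟦ c ∷ σ ⟧ ⊆ ⟦ points ⟧
    ⊆points (here refl) = c∈
    ⊆points (there q∈)  = σ⊆ q∈
    comparable : ∀ {p q} → p ∈ c ∷ σ → q ∈ c ∷ σ → Comparable (coord p) (coord q)
    comparable (here refl) (here refl) = inj₁ refl
    comparable (here refl) (there q∈)  = c~σ q∈
    comparable (there p∈)  (here refl) = Comparable-sym (c~σ p∈)
    comparable (there p∈)  (there q∈)  = cmp p∈ q∈

  face⇒chain : ∀ {σ} → Δ σ → Chain σ
  face⇒chain {σ} = Equivalence.to (Δ⇔chain σ)

  chain⇒face : ∀ {σ} → Chain σ → Δ σ
  chain⇒face {σ} = Equivalence.from (Δ⇔chain σ)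

  isFiniteSimplicialComplex : IsFiniteSimplicialComplex Δ
  isFiniteSimplicialComplex = record
    { empty-face  = chain⇒face ((λ ()) , λ ())
    ; down-closed = λ τ∈Δ σ⊆τ → chain⇒face (chain-⊆ (face⇒chain τ∈Δ) σ⊆τ)
    ; finite      = filter chain? (sublists points) , λ σ → mk⇔ (listed σ) (face σ)
    }
    where
    listed : ∀ σ → Δ σ → Any (σ ≋_) (filter chain? (sublists points))
    -- A face may list its vertices in any order and with repetitions; filtering `points` by
    -- membership in `σ` gives the same set in enumerated form.
    listed σ σ∈Δ = lose (∈-filter⁺ chain? (filter∈sublists (_∈? σ) points)
      (chain-⊆ (face⇒chain σ∈Δ) (proj₂ σ≋ρ))) σ≋ρ
      where
      σ≋ρ : σ ≋ filter (_∈? σ) points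
      σ≋ρ = (λ p∈ → ∈-filter⁺ (_∈? σ) (proj₁ (face⇒chain σ∈Δ) p∈) p∈)
          , (λ p∈ → proj₂ (∈-filter⁻ (_∈? σ) {xs = points} p∈))
    face : ∀ σ → Any (σ ≋_) (filter chain? (sublists points)) → Δ σ
    face σ any with ρ , ρ∈ , σ≋ρ ← find any =
      chain⇒face (chain-⊆ (proj₂ (∈-filter⁻ chain? {xs = sublists points} ρ∈)) (proj₁ σ≋ρ))

  -- Greedy extension: a vertex rejected at one stage stays inadmissible, because a subset of a
  -- chain is a chain.
  extend : ∀ vs σ → Chain σ →
    ∃[ γ ] Chain γ × ⟦ σ ⟧ ⊆ ⟦ γ ⟧ × (∀ {v} → v ∈ vs → Chain (v ∷ γ) → v ∈ γ)
  extend []       σ σ-chain = σ , σ-chain , id , λ ()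
  extend (v ∷ vs) σ σ-chain with chain? (v ∷ σ)
  ... | yes vσ-chain with γ , γ-chain , σ⊆γ , max ← extend vs (v ∷ σ) vσ-chain =
    γ , γ-chain , σ⊆γ ∘ there , λ { (here refl) _ → σ⊆γ (here refl) ; (there u∈) → max u∈ }
  ... | no ¬vσ-chain with γ , γ-chain , σ⊆γ , max ← extend vs σ σ-chain =
    γ , γ-chain , σ⊆γ , λ where
      (here refl) vγ-chain → contradiction (chain-⊆ vγ-chain (keep σ⊆γ)) ¬vσ-chain
      (there u∈)           → max u∈
    where
    keep : ∀ {v σ γ} → ⟦ σ ⟧ ⊆ ⟦ γ ⟧ → ⟦ v ∷ σ ⟧ ⊆ ⟦ v ∷ γ ⟧
    keep σ⊆γ (here e)   = here e
    keep σ⊆γ (there u∈) = there (σ⊆γ u∈)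

  facet-above : ∀ {σ} → Chain σ → ∃[ φ ] ⟦ σ ⟧ ⊆ ⟦ proj₁ {B = IsFacet Δ} φ ⟧
  facet-above {σ} σ-chain with γ , γ-chain , σ⊆γ , max ← extend points σ σ-chain =
    (γ , chain⇒face γ-chain , maximal) , σ⊆γ
    where
    maximal : ∀ τ → Δ τ → ⟦ γ ⟧ ⊆ ⟦ τ ⟧ → γ ≋ τ
    maximal τ τ∈Δ γ⊆τ = γ⊆τ , λ v∈τ → max (proj₁ τ-chain v∈τ)
      (chain-⊆ τ-chain λ { (here refl) → v∈τ ; (there u∈γ) → γ⊆τ u∈γ })
      where
      τ-chain : Chain τ
      τ-chain = face⇒chain τ∈Δ

  facet-chain : (φ : Facet Δ) → Chain (proj₁ φ)
  facet-chain (σ , σ∈Δ , _) = face⇒chain σ∈Δ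

  -- Otherwise adjoining `c` would give a strictly larger face. This turns maximality into
  -- membership of particular points.
  facet-saturated : ((τ , _) : Facet Δ) → ∀ {c} → c ∈ points →
    (∀ {q} → q ∈ τ → Comparable (coord c) (coord q)) → c ∈ τ
  facet-saturated φ@(τ , _ , maximal) {c} c∈ c~τ =
    proj₂ (maximal (c ∷ τ) (chain⇒face (chain-∷ c∈ (facet-chain φ) c~τ)) there)
      (here refl)

  Least : Pred V 0ℓ → List V → Pred V 0ℓ
  Least Q l p = p ∈ l × Q p × (∀ {q} → q ∈ l → Q q → ¬ q ◁ p)

  least : ∀ {Q} (Q? : Decidable Q) l → (∀ {p} → p ∈ l → ¬ Q p) ⊎ ∃[ p ] Least Q l p
  least Q? []      = inj₁ λ ()
  least Q? (v ∷ l) with Q? v | least Q? l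
  ... | no ¬Qv | inj₁ none = inj₁ λ { (here refl) → ¬Qv ; (there p∈) → none p∈ }
  ... | no ¬Qv | inj₂ (p , p∈ , Qp , min) = inj₂ (p , there p∈ , Qp , λ where
    (here refl) Qv → contradiction Qv ¬Qv
    (there q∈)     → min q∈)
  ... | yes Qv | inj₁ none = inj₂ (v , here refl , Qv , λ where
    (here refl) _  → ◁-irrefl refl
    (there q∈)  Qq → contradiction Qq (none q∈))
  ... | yes Qv | inj₂ (p , p∈ , Qp , min) with v ◁? p
  ...   | yes v◁p = inj₂ (v , here refl , Qv , λ where
    (here refl) _      → ◁-irrefl refl
    (there q∈)  Qq q◁v → min q∈ Qq (◁-trans q◁v v◁p))
  ...   | no ¬v◁p = inj₂ (p , there p∈ , Qp , λ where
    (here refl) _ → ¬v◁p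
    (there q∈)    → min q∈)

  -- The least point, in the order ◁, at which σ and τ differ belongs to σ.

  infix 4 _≺_
  _≺_ : Rel (List V) 0ℓ
  σ ≺ τ = ∃[ p ] p ∈ σ × p ∉ τ × (∀ q → q ◁ p → q ∈ σ ⇔ q ∈ τ)

  ≺-irrefl : ∀ {σ τ} → σ ≋ τ → ¬ σ ≺ τ
  ≺-irrefl (σ⊆τ , _) (p , p∈σ , p∉τ , _) = p∉τ (σ⊆τ p∈σ)

  ≺-respʳ : ∀ {σ τ τ′} → τ ≋ τ′ → σ ≺ τ → σ ≺ τ′
  ≺-respʳ (τ⊆ , τ⊇) (p , p∈ , p∉ , agree) = p , p∈ , p∉ ∘ τ⊇ ,
    λ _ q◁p → mk⇔ (τ⊆ ∘ Equivalence.to (agree _ q◁p)) (Equivalence.from (agree _ q◁p) ∘ τ⊇)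

  ≺-respˡ : ∀ {σ σ′ τ} → σ ≋ σ′ → σ ≺ τ → σ′ ≺ τ
  ≺-respˡ (σ⊆ , σ⊇) (p , p∈ , p∉ , agree) = p , σ⊆ p∈ , p∉ ,
    λ _ q◁p → mk⇔ (Equivalence.to (agree _ q◁p) ∘ σ⊇) (σ⊆ ∘ Equivalence.from (agree _ q◁p))

  -- The earlier of the two points of difference is the first difference between `σ` and `υ`; they
  -- cannot coincide, since one lies outside `τ` and the other inside.
  ≺-trans : ∀ {σ τ υ} → Chain σ → Chain τ → σ ≺ τ → τ ≺ υ → σ ≺ υ
  ≺-trans {σ} {τ} {υ} (σ⊆ , _) (τ⊆ , _) (p , p∈σ , p∉τ , σ~τ) (q , q∈τ , q∉υ , τ~υ)
    with ◁-compare (σ⊆ p∈σ) (τ⊆ q∈τ)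
  ... | inj₁ p◁q = p , p∈σ , p∉τ ∘ Equivalence.from (τ~υ _ p◁q) ,
    λ _ r◁p → mk⇔ (Equivalence.to (τ~υ _ (◁-trans r◁p p◁q)) ∘ Equivalence.to (σ~τ _ r◁p))
                (Equivalence.from (σ~τ _ r◁p) ∘ Equivalence.from (τ~υ _ (◁-trans r◁p p◁q)))
  ... | inj₂ (inj₁ refl) = contradiction q∈τ p∉τ
  ... | inj₂ (inj₂ q◁p) = q , Equivalence.from (σ~τ _ q◁p) q∈τ , q∉υ ,
    λ _ r◁q → mk⇔ (Equivalence.to (τ~υ _ r◁q) ∘ Equivalence.to (σ~τ _ (◁-trans r◁q q◁p)))
                (Equivalence.from (σ~τ _ (◁-trans r◁q q◁p)) ∘ Equivalence.from (τ~υ _ r◁q))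

  ≺-asym : ∀ {σ τ} → Chain σ → Chain τ → σ ≺ τ → ¬ τ ≺ σ
  ≺-asym {σ} σ-chain τ-chain σ≺τ τ≺σ =
    ≺-irrefl (≋-refl {σ = σ}) (≺-trans σ-chain τ-chain σ≺τ τ≺σ)

  -- If the symmetric difference is nonempty, its first element decides: the side that owns it comes
  -- first.
  ≺-connex : ∀ {σ τ} → Chain σ → Chain τ → σ ≺ τ ⊎ σ ≋ τ ⊎ τ ≺ σ
  ≺-connex {σ} {τ} (σ⊆ , _) (τ⊆ , _) with least differ? (σ ++ τ)
    where
    Differ : Pred V 0ℓ
    Differ p = (p ∈ σ × p ∉ τ) ⊎ (p ∈ τ × p ∉ σ)
    differ? : Decidable Differ
    differ? p = (p ∈? σ ×-dec ¬? (p ∈? τ)) ⊎-dec (p ∈? τ ×-dec ¬? (p ∈? σ))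
  ... | inj₁ none = inj₂ (inj₁ (σ⊆τ , τ⊆σ))
    where
    σ⊆τ : ⟦ σ ⟧ ⊆ ⟦ τ ⟧
    σ⊆τ {p} p∈ with p ∈? τ
    ... | yes p∈τ = p∈τ
    ... | no  p∉τ = contradiction (inj₁ (p∈ , p∉τ)) (none (∈-++⁺ˡ p∈))
    τ⊆σ : ⟦ τ ⟧ ⊆ ⟦ σ ⟧
    τ⊆σ {p} p∈ with p ∈? σ
    ... | yes p∈σ = p∈σ
    ... | no  p∉σ = contradiction (inj₂ (p∈ , p∉σ)) (none (∈-++⁺ʳ σ p∈))
  ... | inj₂ (p , _ , differ , min) =
    [ (λ (p∈σ , p∉τ) → inj₁ (p , p∈σ , p∉τ , λ _ q◁p → mk⇔ (σ⇒τ q◁p) (τ⇒σ q◁p)))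
    , (λ (p∈τ , p∉σ) → inj₂ (inj₂ (p , p∈τ , p∉σ , λ _ q◁p → mk⇔ (τ⇒σ q◁p) (σ⇒τ q◁p)))) ]′
    differ
    where
    σ⇒τ : ∀ {q} → q ◁ p → q ∈ σ → q ∈ τ
    σ⇒τ {q} q◁p q∈σ with q ∈? τ
    ... | yes q∈τ = q∈τ
    ... | no  q∉τ = contradiction q◁p (min (∈-++⁺ˡ q∈σ) (inj₁ (q∈σ , q∉τ)))
    τ⇒σ : ∀ {q} → q ◁ p → q ∈ τ → q ∈ σ
    τ⇒σ {q} q◁p q∈τ with q ∈? σ
    ... | yes q∈σ = q∈σ
    ... | no  q∉σ = contradiction q◁p (min (∈-++⁺ʳ σ q∈τ) (inj₂ (q∈τ , q∉σ)))

  ≺-isStrictTotalOrder : IsStrictTotalOrder {A = Facet Δ} (_≋_ on proj₁) (_≺_ on proj₁)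
  ≺-isStrictTotalOrder = record
    { isStrictPartialOrder = record
      { isEquivalence = record
        { refl = λ {φ} → ≋-refl {σ = proj₁ φ}
        ; sym = λ {φ} {ψ} → ≋-sym {σ = proj₁ φ} {proj₁ ψ}
        ; trans = λ {φ} {ψ} {χ} → ≋-trans {σ = proj₁ φ} {proj₁ ψ} {proj₁ χ}
        }
      ; irrefl = λ {φ} {ψ} → ≺-irrefl {proj₁ φ} {proj₁ ψ}
      ; trans = λ {φ} {ψ} {χ} → ≺-trans (facet-chain φ) (facet-chain ψ)
      ; <-resp-≈ = (λ {φ} {ψ} {χ} → ≺-respʳ {proj₁ φ} {proj₁ ψ} {proj₁ χ})
                 , (λ {φ} {ψ} {χ} → ≺-respˡ {proj₁ ψ} {proj₁ χ} {proj₁ φ})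
      }
    ; compare = compare
    }
    where
    compare : ∀ φ ψ → Tri (proj₁ φ ≺ proj₁ ψ) (proj₁ φ ≋ proj₁ ψ) (proj₁ ψ ≺ proj₁ φ)
    compare φ@(σ , _) ψ@(τ , _) with ≺-connex (facet-chain φ) (facet-chain ψ)
    ... | inj₁ σ≺τ        = tri< σ≺τ (λ σ≋τ → ≺-irrefl σ≋τ σ≺τ) (≺-asym (facet-chain φ) (facet-chain ψ) σ≺τ)
    ... | inj₂ (inj₁ σ≋τ) = tri≈ (≺-irrefl σ≋τ) σ≋τ (≺-irrefl (≋-sym {σ = σ} {τ} σ≋τ))
    ... | inj₂ (inj₂ τ≺σ) =
      tri> (≺-asym (facet-chain ψ) (facet-chain φ) τ≺σ) (λ σ≋τ → ≺-irrefl (≋-sym {σ = σ} {τ} σ≋τ) τ≺σ) τ≺σ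

  ≺-isShelling : IsShelling Δ (_≺_ on proj₁)
  ≺-isShelling φ@(σ , _) ψ@(τ , _ , τ-maximal) (p , p∈σ , p∉τ , agree)
    with σ⊆ , σ-cmp ← facet-chain φ | τ⊆ , τ-cmp ← facet-chain ψ
    with least (p ◁?_) τ
  -- With no element of `τ` after `p`, all of `τ` lies before `p`, where the facets agree. Then `τ`
  -- is contained in `σ`, and maximality of `τ` forces `p` into `τ`.
  ... | inj₁ none = contradiction (proj₂ (τ-maximal σ (proj₁ (proj₂ φ)) τ⊆σ) p∈σ) p∉τ
    where
    τ⊆σ : ⟦ τ ⟧ ⊆ ⟦ σ ⟧
    τ⊆σ q∈τ with ◁-compare (τ⊆ q∈τ) (σ⊆ p∈σ)
    ... | inj₁ q◁p         = Equivalence.from (agree _ q◁p) q∈τ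
    ... | inj₂ (inj₁ refl) = contradiction q∈τ p∉τ
    ... | inj₂ (inj₂ p◁q)  = contradiction p◁q (none q∈τ)
  ... | inj₂ (t , t∈τ , p◁t , t-min)
    with c , c∈points , c≡p∧t ← meet (σ⊆ p∈σ) (τ⊆ t∈τ) =
      -- The first difference between the new facet and `τ` is `c` itself, and `t` is the vertex of
      -- `τ` that is lost.
      χ , (c , c∈γ , c∉τ , λ _ q◁c → mk⇔ (γ⇒τ q◁c) (τ⇒γ q◁c)) , t , t∈τ
        , (λ (q∈σ , q∈τ) → τ∖t⊆γ q∈τ (λ { refl → t∉σ q∈σ }) , q∈τ)
        , (λ (q∈γ , q∈τ) → q∈τ , λ { refl → t∉γ q∈γ })
        , (λ (q∈τ , t≢q) → τ∖t⊆γ q∈τ (t≢q ∘ sym) , q∈τ)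
    where
    c◁t : c ◁ t
    c◁t = subst (_<ₗ coord t) (sym c≡p∧t) (∧-<ₗ p◁t)

    -- Since `t` is the first element of `τ` after `p`, such a `q` precedes `p` and so belongs to
    -- both facets. Comparability in `σ` and in `τ` gives the two inequalities.
    below : ∀ {q} → q ∈ τ → q ◁ t → coord q ≪ coord p × coord q ≪ coord t
    below {q} q∈τ q◁t with ◁-compare (τ⊆ q∈τ) (σ⊆ p∈σ)
    ... | inj₁ q◁p         = comparable∧<ₗ⇒≪ (σ-cmp (Equivalence.from (agree _ q◁p) q∈τ) p∈σ) q◁p
                           , comparable∧<ₗ⇒≪ (τ-cmp q∈τ t∈τ) q◁t
    ... | inj₂ (inj₁ refl) = contradiction q∈τ p∉τ
    ... | inj₂ (inj₂ p◁q)  = contradiction q◁t (t-min q∈τ p◁q)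

    below-meet : ∀ {q} → q ∈ τ → q ◁ t → coord q ≪ coord c
    below-meet {q} q∈τ q◁t with q≪p , q≪t ← below q∈τ q◁t =
      subst (coord q ≪_) (sym c≡p∧t) (≪-glb q≪p q≪t)

    meet-below : ∀ {q} → coord t ≪ q → coord c ≪ q
    meet-below {q} t≪q = subst (_≪ q) (sym c≡p∧t) (∧-≪ {coord p} t≪q)

    above : ∀ {q} → q ∈ τ → t ◁ q → coord t ≪ coord q
    above q∈τ t◁q = comparable∧<ₗ⇒≪ (τ-cmp t∈τ q∈τ) t◁q

    -- As an element of `τ` before `t`, the point `c` would be strictly below itself by
    -- `below-meet`.
    c∉τ : c ∉ τ
    c∉τ c∈τ = ≪-irrefl (below-meet c∈τ c◁t)

    -- With `t` in `σ`, the point `p` would be strictly below `t` and would fit into `τ` between the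
    -- elements below `t` and `t`; saturation would put it there.
    t∉σ : t ∉ σ
    t∉σ t∈σ = p∉τ (facet-saturated ψ (σ⊆ p∈σ) p~τ)
      where
      p≪t : coord p ≪ coord t
      p≪t = comparable∧<ₗ⇒≪ (σ-cmp p∈σ t∈σ) p◁t
      p~τ : ∀ {q} → q ∈ τ → Comparable (coord p) (coord q)
      p~τ q∈τ with ◁-compare (τ⊆ q∈τ) (τ⊆ t∈τ)
      ... | inj₁ q◁t         = inj₂ (inj₂ (proj₁ (below q∈τ q◁t)))
      ... | inj₂ (inj₁ refl) = inj₂ (inj₁ p≪t)
      ... | inj₂ (inj₂ t◁q)  = inj₂ (inj₁ (≪-trans p≪t (above q∈τ t◁q)))
        where
        ≪-trans : ∀ {p q r} → p ≪ q → q ≪ r → p ≪ r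
        ≪-trans (a , b) (d , e) = ℕ.<-trans a d , ℕ.<-trans b e

    c~τ : ∀ {q} → q ∈ τ → q ≢ t → Comparable (coord c) (coord q)
    c~τ q∈τ q≢t with ◁-compare (τ⊆ q∈τ) (τ⊆ t∈τ)
    ... | inj₁ q◁t        = inj₂ (inj₂ (below-meet q∈τ q◁t))
    ... | inj₂ (inj₁ q≡t) = contradiction q≡t q≢t
    ... | inj₂ (inj₂ t◁q) = inj₂ (inj₁ (meet-below (above q∈τ t◁q)))

    ≢t? : Decidable (_≢ t)
    ≢t? q = ¬? (q ≟ⱽ t)

    exchanged : Chain (c ∷ filter ≢t? τ)
    exchanged = chain-∷ c∈points
      (chain-⊆ (τ⊆ , τ-cmp) (proj₁ ∘ ∈-filter⁻ ≢t? {xs = τ}))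
      (λ q∈ → let q∈τ , q≢t = ∈-filter⁻ ≢t? {xs = τ} q∈ in c~τ q∈τ q≢t)

    χ : Facet Δ
    χ = proj₁ (facet-above exchanged)

    γ : List V
    γ = proj₁ χ

    ⊆γ : ⟦ c ∷ filter ≢t? τ ⟧ ⊆ ⟦ γ ⟧
    ⊆γ = proj₂ (facet-above exchanged)

    γ-chain : Chain γ
    γ-chain = facet-chain χ

    γ⊆ : ⟦ γ ⟧ ⊆ ⟦ points ⟧
    γ⊆ = proj₁ γ-chain

    c∈γ : c ∈ γ
    c∈γ = ⊆γ (here refl)

    τ∖t⊆γ : ∀ {q} → q ∈ τ → q ≢ t → q ∈ γ
    τ∖t⊆γ q∈τ q≢t = ⊆γ (there (∈-filter⁺ ≢t? q∈τ q≢t))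

    -- q lies below t and is comparable to τ ∖ {t} ⊆ γ, so maximality of τ puts it in τ.
    saturated : ∀ {q} → q ∈ γ → coord q ≪ coord t → q ∈ τ
    saturated {q} q∈γ q≪t = facet-saturated ψ (γ⊆ q∈γ) q~τ
      where
      q~τ : ∀ {r} → r ∈ τ → Comparable (coord q) (coord r)
      q~τ {r} r∈τ with r ≟ⱽ t
      ... | yes refl = inj₂ (inj₁ q≪t)
      ... | no  r≢t  = proj₂ γ-chain q∈γ (τ∖t⊆γ r∈τ r≢t)

    -- If both `c` and `t` were in the chain `γ`, then `c ≪ t`, and `saturated` would put `c` in
    -- `τ`.
    t∉γ : t ∉ γ
    t∉γ t∈γ = c∉τ (saturated c∈γ (comparable∧<ₗ⇒≪ (proj₂ γ-chain c∈γ t∈γ) c◁t))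

    γ⇒τ : ∀ {q} → q ◁ c → q ∈ γ → q ∈ τ
    γ⇒τ {q} q◁c q∈γ = saturated q∈γ
      (≪-∧ {q = coord p} (subst (coord q ≪_) c≡p∧t (comparable∧<ₗ⇒≪ (proj₂ γ-chain q∈γ c∈γ) q◁c)))

    τ⇒γ : ∀ {q} → q ◁ c → q ∈ τ → q ∈ γ
    τ⇒γ {q} q◁c q∈τ = τ∖t⊆γ q∈τ λ { refl → ◁-asym {q} {c} q◁c c◁t }

  shellable : Shellable Δ
  shellable = (_≺_ on proj₁) , ≺-isStrictTotalOrder , ≺-isShelling

-- Letter counts along a word and the comparability of valleys.

tally : ℕ → Word → Point
tally i w = count U i w , count D i w

advance : Letter → Point → Point
advance U (x , y) = suc x , y
advance D (x , y) = x , suc y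

rank : Point → ℕ
rank (x , y) = x + y

advance-comm : ∀ c ℓ p → advance c (advance ℓ p) ≡ advance ℓ (advance c p)
advance-comm U U p = refl
advance-comm U D p = refl
advance-comm D U p = refl
advance-comm D D p = refl

rank-advance : ∀ ℓ p → rank (advance ℓ p) ≡ suc (rank p)
rank-advance U p       = refl
rank-advance D (x , y) = ℕ.+-suc x y

tally-∷ : ∀ c i w → tally (suc i) (c ∷ w) ≡ advance c (tally i w)
tally-∷ U i w = refl
tally-∷ D i w = refl

-- Counts unfold at the front of the word, while the new letter is at the end of the prefix;
-- commuting steps reconcile the two.
tally-suc : ∀ i w {ℓ} → w at suc i ≡ just ℓ → tally (suc i) w ≡ advance ℓ (tally i w)
tally-suc zero    (c ∷ w) refl = tally-∷ c 0 w
tally-suc (suc i) (c ∷ w) {ℓ} w-at = begin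
  tally (suc (suc i)) (c ∷ w)       ≡⟨ tally-∷ c (suc i) w ⟩
  advance c (tally (suc i) w)       ≡⟨ cong (advance c) (tally-suc i w w-at) ⟩
  advance c (advance ℓ (tally i w)) ≡⟨ advance-comm c ℓ (tally i w) ⟩
  advance ℓ (advance c (tally i w)) ≡⟨ cong (advance ℓ) (tally-∷ c i w) ⟨
  advance ℓ (tally (suc i) (c ∷ w)) ∎
  where open ≡-Reasoning

rank-tally : ∀ i w → i ≤ length w → rank (tally i w) ≡ i
rank-tally zero    w       _         = refl
rank-tally (suc i) (c ∷ w) (s≤s i≤∣w∣) = begin
  rank (tally (suc i) (c ∷ w))   ≡⟨ cong rank (tally-∷ c i w) ⟩
  rank (advance c (tally i w))   ≡⟨ rank-advance c (tally i w) ⟩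
  suc (rank (tally i w))         ≡⟨ cong suc (rank-tally i w i≤∣w∣) ⟩
  suc i                            ∎
  where open ≡-Reasoning

count-mono : ∀ ℓ w {i j} → i ≤ j → count ℓ i w ≤ count ℓ j w
count-mono ℓ w       z≤n       = z≤n
count-mono ℓ []      (s≤s i≤j) = z≤n
count-mono U (U ∷ w) (s≤s i≤j) = s≤s (count-mono U w i≤j)
count-mono U (D ∷ w) (s≤s i≤j) = count-mono U w i≤j
count-mono D (U ∷ w) (s≤s i≤j) = count-mono D w i≤j
count-mono D (D ∷ w) (s≤s i≤j) = s≤s (count-mono D w i≤j)

-- The U leaving the earlier valley makes the first coordinate grow strictly, and the D entering the
-- later one does so for the second.
valley-≪ : ∀ w {i j} → IsValley w i → IsValley w j → i < j → tally i w ≪ tally j w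
valley-≪ w {i} {suc j} (_ , _ , _ , up) (_ , _ , down , _) i<sj@(s≤s i≤j) =
  ℕ.≤-trans (ℕ.≤-reflexive (sym (cong proj₁ (tally-suc i w up)))) (count-mono U w i<sj) ,
  ℕ.≤-trans (s≤s (count-mono D w i≤j)) (ℕ.≤-reflexive (sym (cong proj₂ (tally-suc j w down))))

valley-comparable : ∀ w {i j} → IsValley w i → IsValley w j → Comparable (tally i w) (tally j w)
valley-comparable w {i} {j} i-valley j-valley with ℕ.<-cmp i j
... | tri< i<j _ _  = inj₂ (inj₁ (valley-≪ w i-valley j-valley i<j))
... | tri≈ _ refl _ = inj₁ refl
... | tri> _ _ j<i  = inj₂ (inj₂ (valley-≪ w j-valley i-valley j<i))

applyUpTo-at : ∀ (f : ℕ → Letter) {n i} → i < n → applyUpTo f n at suc i ≡ just (f i)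
applyUpTo-at f {suc n} {zero}  _         = refl
applyUpTo-at f {suc n} {suc i} (s≤s i<n) = applyUpTo-at (f ∘ suc) i<n

-- Construction of a path with prescribed valleys.

-- The path with valleys ρ and endpoint e is walked greedily: step down as long as some point
-- of L that is not to the right is strictly higher.  OnPath describes the points visited,
-- and contains only one point on each line x + y = i.

module PathThrough
  (e : Point) (ρ : List Point)
  (ρ-comparable : ∀ {p q} → p ∈ ρ → q ∈ ρ → Comparable p q)
  (ρ≪e : ∀ {p} → p ∈ ρ → p ≪ e)
  (ρ-positive : ∀ {p} → p ∈ ρ → 1 ≤ proj₂ p)
  where

  -- The endpoint is treated as one more corner, so that arriving there is an instance of visiting a
  -- point of `L`.
  L : List Point
  L = e ∷ ρ

  L-comparable : ∀ {p q} → p ∈ L → q ∈ L → Comparable p q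
  L-comparable (here refl) (here refl) = inj₁ refl
  L-comparable (here refl) (there q∈)  = inj₂ (inj₂ (ρ≪e q∈))
  L-comparable (there p∈)  (here refl) = inj₂ (inj₁ (ρ≪e p∈))
  L-comparable (there p∈)  (there q∈)  = ρ-comparable p∈ q∈

  Under : Pred Point 0ℓ
  Under (x , y) = Any (λ (u , v) → u ≤ x × y < v) L

  under? : Decidable Under
  under? (x , y) = any? (λ (u , v) → u ℕ.≤? x ×-dec y ℕ.<? v) L

  letter : Point → Letter
  letter p with under? p
  ... | yes _ = D
  ... | no  _ = U

  letter-D : ∀ {p} → Under p → letter p ≡ D
  letter-D {p} u with under? p
  ... | yes _  = refl
  ... | no  ¬u = contradiction u ¬u

  letter-U : ∀ {p} → ¬ Under p → letter p ≡ U
  letter-U {p} ¬u with under? p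
  ... | yes u = contradiction u ¬u
  ... | no  _ = refl

  letter-D⁻ : ∀ p → letter p ≡ D → Under p
  letter-D⁻ p eq with under? p
  ... | yes u = u

  letter-U⁻ : ∀ p → letter p ≡ U → ¬ Under p
  letter-U⁻ p eq with under? p
  ... | no ¬u = ¬u

  walk : ℕ → Point
  walk zero    = 0 , 0
  walk (suc i) = advance (letter (walk i)) (walk i)

  -- A staircase condition: `y` is at least every height in `L` strictly left of `x` and at most the
  -- greatest height weakly left of `x`, or 0 if there is none.
  OnPath : Pred Point 0ℓ
  OnPath (x , y) =
    (∀ {u v} → (u , v) ∈ L → u < x → v ≤ y) ×
    (y ≡ 0 ⊎ ∃[ q ] q ∈ L × proj₁ q ≤ x × y ≤ proj₂ q)

  -- For a D step, the point of `L` that triggered it bounds the new height. For a U step, the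
  -- absence of such a point is what the first clause requires at `suc x`.
  OnPath-advance : ∀ p → OnPath p → OnPath (advance (letter p) p)
  OnPath-advance p@(x , y) (left , right) with under? p
  ... | yes u with q , q∈ , u≤x , y<v ← find u =
    (λ q∈ u<x → ℕ.m≤n⇒m≤1+n (left q∈ u<x)) , inj₂ (q , q∈ , u≤x , y<v)
  ... | no ¬u =
    (λ q∈ u<1+x → ℕ.≮⇒≥ λ y<v → ¬u (lose q∈ (ℕ.≤-pred u<1+x , y<v))) ,
    [ inj₁ , (λ (q , q∈ , u≤x , y≤v) → inj₂ (q , q∈ , ℕ.m≤n⇒m≤1+n u≤x , y≤v)) ]′ right

  OnPath-walk : ∀ i → OnPath (walk i)
  OnPath-walk zero    = (λ _ ()) , inj₁ refl
  OnPath-walk (suc i) = OnPath-advance (walk i) (OnPath-walk i)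

  rank-walk : ∀ i → rank (walk i) ≡ i
  rank-walk zero    = refl
  rank-walk (suc i) = trans (rank-advance (letter (walk i)) (walk i)) (cong suc (rank-walk i))

  -- On one antidiagonal `x < x′` forces `y′ < y`. But `y` is bounded by a height in `L` weakly left
  -- of `x`, hence strictly left of `x′`, and `y′` has already reached that height.
  OnPath-≮ : ∀ p q → OnPath p → OnPath q → rank p ≡ rank q → ¬ proj₁ p < proj₁ q
  OnPath-≮ (x , y) (x′ , y′) (_ , right) (left , _) eq x<x′ = ℕ.<⇒≱ y′<y (y≤y′ right)
    where
    y′<y : y′ < y
    y′<y = ℕ.≰⇒> λ y≤y′ → ℕ.<⇒≢ (ℕ.+-mono-<-≤ x<x′ y≤y′) eq
    y≤y′ : y ≡ 0 ⊎ ∃[ q ] q ∈ L × proj₁ q ≤ x × y ≤ proj₂ q → y ≤ y′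
    y≤y′ (inj₁ refl)                    = z≤n
    y≤y′ (inj₂ ((u , v) , q∈ , u≤x , y≤v)) = ℕ.≤-trans y≤v (left q∈ (ℕ.≤-<-trans u≤x x<x′))

  OnPath-unique : ∀ {p q} → OnPath p → OnPath q → rank p ≡ rank q → p ≡ q
  OnPath-unique {p@(x , y)} {q@(x′ , y′)} p-on q-on eq with ℕ.<-cmp x x′
  ... | tri< x<x′ _ _ = contradiction x<x′ (OnPath-≮ p q p-on q-on eq)
  ... | tri≈ _ refl _ = cong (x ,_) (ℕ.+-cancelˡ-≡ x y y′ eq)
  ... | tri> _ _ x′<x = contradiction x′<x (OnPath-≮ q p q-on p-on (sym eq))

  -- Whether the walk visits a point can thus be decided from the inequalities in `OnPath`, without
  -- following the walk.
  walk-rank : ∀ {p} → OnPath p → walk (rank p) ≡ p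
  walk-rank {p} p-on = OnPath-unique (OnPath-walk (rank p)) p-on (rank-walk (rank p))

  L-left : ∀ {u v x y} → (u , v) ∈ L → (x , y) ∈ L → u < x → v < y
  L-left p∈ q∈ u<x with L-comparable p∈ q∈
  ... | inj₁ refl               = contradiction u<x (ℕ.<-irrefl refl)
  ... | inj₂ (inj₁ (_ , v<y))   = v<y
  ... | inj₂ (inj₂ (x<u , _))   = contradiction u<x (ℕ.<-asym x<u)

  OnPath-∈ : ∀ {q} → q ∈ L → OnPath q
  OnPath-∈ q∈ = (λ p∈ u<x → ℕ.<⇒≤ (L-left p∈ q∈ u<x)) , inj₂ (_ , q∈ , ℕ.≤-refl , ℕ.≤-refl)

  -- The walk passes just below each corner, so the corner is entered by a D.
  OnPath-below : ∀ {x y} → (x , suc y) ∈ L → OnPath (x , y)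
  OnPath-below q∈ =
    (λ p∈ u<x → ℕ.≤-pred (L-left p∈ q∈ u<x)) , inj₂ (_ , q∈ , ℕ.≤-refl , ℕ.n≤1+n _)

  -- Comparability excludes a point of `L` weakly left of `q` and strictly higher; hence the walk
  -- leaves a point of `ρ` by a U.
  ¬Under-∈ : ∀ {q} → q ∈ L → ¬ Under q
  ¬Under-∈ {x , y} q∈ u with p , p∈ , u≤x , y<v ← find u with L-comparable p∈ q∈
  ... | inj₁ refl               = ℕ.<-irrefl refl y<v
  ... | inj₂ (inj₁ (_ , v<y))   = ℕ.<-asym y<v v<y
  ... | inj₂ (inj₂ (x<u , _))   = ℕ.<⇒≱ x<u u≤x

  path : Word
  path = applyUpTo (letter ∘ walk) (rank e)

  length-path : length path ≡ rank e
  length-path = length-applyUpTo (letter ∘ walk) (rank e)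

  path-at : ∀ i → i < rank e → path at suc i ≡ just (letter (walk i))
  path-at _ = applyUpTo-at (letter ∘ walk)

  tally-path : ∀ i → i ≤ rank e → tally i path ≡ walk i
  tally-path zero    _     = refl
  tally-path (suc i) i<r = begin
    tally (suc i) path                       ≡⟨ tally-suc i path (path-at i i<r) ⟩
    advance (letter (walk i)) (tally i path) ≡⟨ cong (advance _) (tally-path i (ℕ.<⇒≤ i<r)) ⟩
    walk (suc i)                             ∎
    where open ≡-Reasoning

  tally-end : tally (length path) path ≡ e
  tally-end = trans (cong (λ r → tally r path) length-path)
    (trans (tally-path (rank e) ℕ.≤-refl) (walk-rank (OnPath-∈ (here refl))))

  rank-< : ∀ {q} → q ∈ ρ → rank q < rank e
  rank-< q∈ = ℕ.+-mono-< (proj₁ (ρ≪e q∈)) (proj₂ (ρ≪e q∈))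

  tally-rank : ∀ {q} → q ∈ ρ → tally (rank q) path ≡ q
  tally-rank q∈ = trans (tally-path _ (ℕ.<⇒≤ (rank-< q∈))) (walk-rank (OnPath-∈ (there q∈)))

  ∈⇒valley : ∀ {q} → q ∈ ρ → IsValley path (rank q)
  -- A valley needs a preceding D, which a point of height 0 could not have.
  ∈⇒valley {x , zero}  q∈ with () ← ρ-positive q∈
  ∈⇒valley {q@(x , suc y)} q∈ =
    ℕ.≤-trans (s≤s z≤n) (ℕ.m≤n+m (suc y) x) ,
    subst (rank q <_) (sym length-path) (rank-< q∈) ,
    subst (λ i → path at i ≡ just D) (sym (ℕ.+-suc x y)) down ,
    trans (path-at (rank q) (rank-< q∈))
      (cong just (trans (cong letter (walk-rank (OnPath-∈ (there q∈)))) (letter-U (¬Under-∈ (there q∈)))))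
    where
    down : path at suc (x + y) ≡ just D
    down = trans (path-at (x + y) (ℕ.≤-trans (ℕ.≤-reflexive (sym (ℕ.+-suc x y))) (ℕ.<⇒≤ (rank-< q∈))))
      (cong just (trans (cong letter (walk-rank (OnPath-below (there q∈))))
        (letter-D (lose (there q∈) (ℕ.≤-refl , ℕ.n<1+n y)))))

  -- The D comes from a point of `L` weakly left and strictly higher. It cannot be strictly left, by
  -- the first clause of `OnPath`, and the following U shows that it is exactly one unit higher. It
  -- is not `e`, whose rank is too large.
  valley⇒∈ : ∀ {i} → IsValley path i → tally i path ∈ ρ
  valley⇒∈ {suc i} (_ , i<len , down , up) =
    subst (_∈ ρ) (sym (tally-path (suc i) (ℕ.<⇒≤ 1+i<r))) (∈ρ (subst (_∈ L) (sym walk≡) corner∈L))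
    where
    1+i<r : suc i < rank e
    1+i<r = subst (suc i <_) length-path i<len
    i-down : letter (walk i) ≡ D
    i-down = just-injective (trans (sym (path-at i (ℕ.<⇒≤ 1+i<r))) down)
    1+i-up : letter (walk (suc i)) ≡ U
    1+i-up = just-injective (trans (sym (path-at (suc i) 1+i<r)) up)
    walk≡ : walk (suc i) ≡ advance D (walk i)
    walk≡ = cong (λ ℓ → advance ℓ (walk i)) i-down
    ¬under : ¬ Under (advance D (walk i))
    ¬under = subst (¬_ ∘ Under) walk≡ (letter-U⁻ (walk (suc i)) 1+i-up)
    corner∈L : advance D (walk i) ∈ L
    corner∈L with (u , v) , q∈ , u≤x , y<v ← find (letter-D⁻ (walk i) i-down) =
      subst (_∈ L) (cong₂ _,_
        (ℕ.≤-antisym u≤x (ℕ.≮⇒≥ λ u<x → ℕ.<⇒≱ y<v (proj₁ (OnPath-walk i) q∈ u<x)))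
        (ℕ.≤-antisym (ℕ.≮⇒≥ λ 1+y<v → ¬under (lose q∈ (u≤x , 1+y<v))) y<v)) q∈
    ∈ρ : walk (suc i) ∈ L → walk (suc i) ∈ ρ
    ∈ρ (here ≡e)  = contradiction (trans (sym (rank-walk (suc i))) (cong rank ≡e)) (ℕ.<⇒≢ 1+i<r)
    ∈ρ (there ∈ρ) = ∈ρ

  -- A visited point has height 0 or lies weakly right of and no higher than a point of `L`; moving
  -- right or lowering the height preserves the slope condition.
  walk-slope : ∀ {a b} → (∀ {u v} → (u , v) ∈ L → b * v ≤ a * u) →
    ∀ i → let (x , y) = walk i in b * y ≤ a * x
  walk-slope {a} {b} slope i with proj₂ (OnPath-walk i)
  ... | inj₁ y≡0 = ℕ.≤-trans (ℕ.≤-reflexive (trans (cong (b *_) y≡0) (ℕ.*-zeroʳ b))) z≤n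
  ... | inj₂ (q , q∈ , u≤x , y≤v) =
    ℕ.≤-trans (ℕ.*-monoʳ-≤ b y≤v) (ℕ.≤-trans (slope q∈) (ℕ.*-monoʳ-≤ a u≤x))

-- Positions as lattice points, and the region of possible valleys.

-- A position (i , h) has i = x + y and h = x − y.

pos : Point → Position
pos (x , y) = + (x + y) , + x ℤ.- + y

position≡pos : ∀ w i → i ≤ length w → position w i ≡ pos (tally i w)
position≡pos w i i≤ = cong (λ j → + j , + count U i w ℤ.- + count D i w) (sym (rank-tally i w i≤))

-- Inverse of `pos`: on its image `i + h` is twice `x`, so the absolute values, the halving and the
-- truncated subtraction are all exact there.
coord : Position → Point
coord (i , h) = let x = ⌊ ∣ i ℤ.+ h ∣ /2⌋ in x , ∣ i ∣ ∸ x

coord-pos : ∀ p → coord (pos p) ≡ p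
coord-pos (x , y) =
  trans (cong (λ k → ⌊ ∣ k ∣ /2⌋ , x + y ∸ ⌊ ∣ k ∣ /2⌋) (double (+ x) (+ y)))
    (trans (cong (λ k → k , x + y ∸ k) (sym (ℕ.n≡⌊n+n/2⌋ x))) (cong (x ,_) (ℕ.m+n∸m≡n x y)))
  where
  double : ∀ x y → (x ℤ.+ y) ℤ.+ (x ℤ.- y) ≡ x ℤ.+ x
  double = solve-∀

-- A valley is entered by a D, whence `1 ≤ y`, and left by a U, whence `x < n * b`.
Region : ℕ → ℕ → ℕ → Pred Point 0ℓ
Region a b n (x , y) = 1 ≤ y × b * y ≤ a * x × x < n * b

region? : ∀ a b n → Decidable (Region a b n)
region? a b n (x , y) = 1 ℕ.≤? y ×-dec b * y ℕ.≤? a * x ×-dec x ℕ.<? n * b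

-- The slope condition survives because multiplication by `a` or `b` distributes over `⊓`.
region-∧ : ∀ {a b n} p q → Region a b n p → Region a b n q → Region a b n (p ∧ q)
region-∧ {a} {b} {n} (x , y) (x′ , y′) (1≤y , slope , x<) (1≤y′ , slope′ , x′<) =
  ℕ.⊓-glb 1≤y 1≤y′ ,
  subst₂ _≤_ (sym (ℕ.*-distribˡ-⊓ b y y′)) (sym (ℕ.*-distribˡ-⊓ a x x′)) (ℕ.⊓-mono-≤ slope slope′) ,
  ℕ.≤-<-trans (ℕ.m⊓n≤m x x′) x<

-- The height bound comes from the slope condition and `x < n * b`; positivity of `a` keeps the
-- inequality strict.
region-≪ : ∀ {a b n} → 1 ≤ a → ∀ p → Region a b n p → p ≪ (n * b , n * a)
region-≪ {a@(suc _)} {b} {n} _ (x , y) (_ , slope , x<) = x< , ℕ.*-cancelˡ-< b _ _ (begin-strict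
  b * y       ≤⟨ slope ⟩
  a * x       <⟨ ℕ.*-monoʳ-< a x< ⟩
  a * (n * b) ≡⟨ ℕ.*-comm a (n * b) ⟩
  n * b * a   ≡⟨ cong (_* a) (ℕ.*-comm n b) ⟩
  b * n * a   ≡⟨ ℕ.*-assoc b n a ⟩
  b * (n * a) ∎)
  where open ℕ.≤-Reasoning

-- Faces of `ΔDyck` are the chains in the region.

module DyckChains (a b n : ℕ) (1≤a : 1 ≤ a) where

  end : Point
  end = n * b , n * a

  end-slope : b * (n * a) ≡ a * (n * b)
  end-slope = begin
    b * (n * a) ≡⟨ ℕ.*-comm b (n * a) ⟩
    n * a * b   ≡⟨ cong (_* b) (ℕ.*-comm n a) ⟩
    a * n * b   ≡⟨ ℕ.*-assoc a n b ⟩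
    a * (n * b) ∎
    where open ≡-Reasoning

  -- By `region-≪` this rectangle contains the whole region.
  grid : List Point
  grid = cartesianProduct (upTo (n * b)) (upTo (n * a))

  points : List Position
  points = map pos (filter (region? a b n) grid)

  pos∈points : ∀ {p} → Region a b n p → pos p ∈ points
  pos∈points {p} p∈ with x< , y< ← region-≪ {a} {b} {n} 1≤a p p∈ =
    ∈-map⁺ pos (∈-filter⁺ (region? a b n) {xs = grid} (∈-cartesianProduct⁺ (∈-upTo⁺ x<) (∈-upTo⁺ y<)) p∈)

  points⁻ : ∀ {v} → v ∈ points → Region a b n (coord v) × pos (coord v) ≡ v
  points⁻ v∈ with p , p∈ , refl ← ∈-map⁻ pos v∈ =
    subst (Region a b n) (sym (coord-pos p)) (proj₂ (∈-filter⁻ (region? a b n) {xs = grid} p∈)) ,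
    cong pos (coord-pos p)

  coord-injective : ∀ {u v} → u ∈ points → v ∈ points → coord u ≡ coord v → u ≡ v
  coord-injective u∈ v∈ eq = trans (sym (proj₂ (points⁻ u∈))) (trans (cong pos eq) (proj₂ (points⁻ v∈)))

  meet : ∀ {u v} → u ∈ points → v ∈ points → ∃[ c ] c ∈ points × coord c ≡ coord u ∧ coord v
  meet {u} {v} u∈ v∈ = pos (coord u ∧ coord v)
    , pos∈points (region-∧ {a} {b} {n} (coord u) (coord v) (proj₁ (points⁻ u∈)) (proj₁ (points⁻ v∈)))
    , coord-pos (coord u ∧ coord v)

  valley-region : ∀ {w} → Dyck a b n w → ∀ {i} → IsValley w i → Region a b n (tally i w)
  valley-region {w} ((slope , _) , ends , _) {suc i} (1≤i , i< , down , up) =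
    subst (1 ≤_) (sym (cong proj₂ (tally-suc i w down))) (s≤s z≤n) ,
    slope (suc i) 1≤i i< ,
    (begin
      suc (count U (suc i) w)  ≡⟨ cong proj₁ (tally-suc (suc i) w up) ⟨
      count U (suc (suc i)) w  ≤⟨ count-mono U w i< ⟩
      count U (length w) w     ≡⟨ ends ⟩
      n * b                    ∎)
    where open ℕ.≤-Reasoning

  face⇒chain : ∀ {σ} → ΔDyck a b n σ → IsChain coord points σ
  face⇒chain {σ} (w , w-dyck , σ⊆ , _) = ⊆points , comparable
    where
    valley-pos : ∀ {i} → IsValley w i → position w i ≡ pos (tally i w)
    valley-pos {i} (_ , i< , _) = position≡pos w i (ℕ.<⇒≤ i<)
    ⊆points : ⟦ σ ⟧ ⊆ ⟦ points ⟧
    ⊆points v∈ with i , i-valley , refl ← σ⊆ v∈ =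
      subst (_∈ points) (sym (valley-pos i-valley)) (pos∈points (valley-region w-dyck i-valley))
    coord-valley : ∀ {i} → IsValley w i → coord (position w i) ≡ tally i w
    coord-valley i-valley = trans (cong coord (valley-pos i-valley)) (coord-pos _)
    comparable : ∀ {u v} → u ∈ σ → v ∈ σ → Comparable (coord u) (coord v)
    comparable u∈ v∈ with i , i-valley , refl ← σ⊆ u∈ | j , j-valley , refl ← σ⊆ v∈ =
      subst₂ Comparable (sym (coord-valley i-valley)) (sym (coord-valley j-valley))
        (valley-comparable w i-valley j-valley)

  -- The witness is the greedy path from `PathThrough` with corners at the points of `σ` and
  -- endpoint `end`.
  chain⇒face : ∀ {σ} → IsChain coord points σ → ΔDyck a b n σ
  chain⇒face {σ} (σ⊆ , σ-comparable) =
    path , ((slope , end-on-line) , cong proj₁ tally-end , cong proj₂ tally-end , len) , σ⊆valleys , valleys⊆σ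
    where
    region : ∀ {p} → p ∈ map coord σ → Region a b n p
    region p∈ with v , v∈ , refl ← ∈-map⁻ coord p∈ = proj₁ (points⁻ (σ⊆ v∈))
    comparable : ∀ {p q} → p ∈ map coord σ → q ∈ map coord σ → Comparable p q
    comparable p∈ q∈ with u , u∈ , refl ← ∈-map⁻ coord p∈ | v , v∈ , refl ← ∈-map⁻ coord q∈ =
      σ-comparable u∈ v∈
    open PathThrough end (map coord σ) comparable
      (λ {p} p∈ → region-≪ {a} {b} {n} 1≤a p (region p∈)) (proj₁ ∘ region)
    L-slope : ∀ {u v} → (u , v) ∈ L → b * v ≤ a * u
    L-slope (here refl) = ℕ.≤-reflexive end-slope
    L-slope (there p∈)  = proj₁ (proj₂ (region p∈))
    slope : ∀ i → 1 ≤ i → i < length path → b * count D i path ≤ a * count U i path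
    slope i _ i< = subst (λ (x , y) → b * y ≤ a * x)
      (sym (tally-path i (ℕ.≤-trans (ℕ.<⇒≤ i<) (ℕ.≤-reflexive length-path)))) (walk-slope {a} {b} L-slope i)
    end-on-line : b * count D (length path) path ≡ a * count U (length path) path
    end-on-line = subst (λ (x , y) → b * y ≡ a * x) (sym tally-end) end-slope
    len : length path ≡ n * (a + b)
    len = trans length-path (trans (ℕ.+-comm (n * b) (n * a)) (sym (ℕ.*-distribˡ-+ n a b)))
    valley-pos : ∀ {i} → IsValley path i → position path i ≡ pos (tally i path)
    valley-pos {i} (_ , i< , _) = position≡pos path i (ℕ.<⇒≤ i<)
    σ⊆valleys : ⟦ σ ⟧ ⊆ valleys path
    σ⊆valleys {v} v∈ with p∈ ← ∈-map⁺ coord v∈ = rank (coord v) , ∈⇒valley p∈ , sym (begin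
      position path (rank (coord v))    ≡⟨ valley-pos (∈⇒valley p∈) ⟩
      pos (tally (rank (coord v)) path) ≡⟨ cong pos (tally-rank p∈) ⟩
      pos (coord v)                       ≡⟨ proj₂ (points⁻ (σ⊆ v∈)) ⟩
      v                                   ∎)
      where open ≡-Reasoning
    valleys⊆σ : valleys path ⊆ ⟦ σ ⟧
    valleys⊆σ (i , i-valley , refl) with v , v∈ , eq ← ∈-map⁻ coord (valley⇒∈ i-valley) =
      subst (_∈ σ) (sym (trans (valley-pos i-valley) (trans (cong pos eq) (proj₂ (points⁻ (σ⊆ v∈)))))) v∈

  face⇔chain : ∀ σ → ΔDyck a b n σ ⇔ IsChain coord points σ
  face⇔chain σ = mk⇔ face⇒chain chain⇒face

  open ChainComplex (≡-dec ℤ._≟_ ℤ._≟_) coord points coord-injective meet (ΔDyck a b n) face⇔chain public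
    using (isFiniteSimplicialComplex; shellable)

-- Classical Dyck paths and antichains of positive roots of type A.

-- The valley of a classical Dyck path at (x , y) corresponds to the root e_y − e_{x+1}.

rootPoint : ∀ {m} → Root m → Point
rootPoint ((i , j) , _) = toℕ j , suc (toℕ i)

rootPoint-injective : ∀ {m} {α β : Root m} → rootPoint α ≡ rootPoint β → α ≡ β
rootPoint-injective {α = (i , j) , i<j} {(i′ , j′) , i′<j′} eq
  with refl ← Fin.toℕ-injective {i = j} {j′} (cong proj₁ eq)
     | refl ← Fin.toℕ-injective {i = i} {i′} (ℕ.suc-injective (cong proj₂ eq))
  = cong (_ ,_) (ℕ.<-irrelevant i<j i′<j′)

rootPoint-region : ∀ {m} (α : Root m) → Region 1 1 (suc m) (rootPoint α)
rootPoint-region {m} ((i , j) , i<j) =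
  s≤s z≤n , ℕ.*-monoʳ-≤ 1 i<j , subst (toℕ j <_) (sym (ℕ.*-identityʳ (suc m))) (Fin.toℕ<n j)

region-root : ∀ {m p} → Region 1 1 (suc m) p → Σ[ α ∈ Root m ] rootPoint α ≡ p
region-root {m} {x , suc y} (_ , slope , x<) =
  ((fromℕ< y<1+m , fromℕ< x<1+m) , subst₂ _<_ (sym toℕ-y) (sym toℕ-x) y<x) ,
  cong₂ _,_ toℕ-x (cong suc toℕ-y)
  where
  x<1+m : x < suc m
  x<1+m = subst (x <_) (ℕ.*-identityʳ (suc m)) x<
  y<x : y < x
  y<x = ℕ.*-cancelˡ-≤ 1 slope
  y<1+m : y < suc m
  y<1+m = ℕ.<-trans y<x x<1+m
  toℕ-x : toℕ (fromℕ< x<1+m) ≡ x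
  toℕ-x = Fin.toℕ-fromℕ< x<1+m
  toℕ-y : toℕ (fromℕ< y<1+m) ≡ y
  toℕ-y = Fin.toℕ-fromℕ< y<1+m

-- The root order is containment of the intervals from `i` to `j`. Without containment both
-- endpoints shift strictly in the same direction, so incomparable roots give comparable points.
antichain⇔comparable : ∀ {m} (σ : List (Root m)) →
  ΔA m σ ⇔ (∀ {α β} → α ∈ σ → β ∈ σ → Comparable (rootPoint α) (rootPoint β))
antichain⇔comparable {m} σ = mk⇔ comparable antichain
  where
  comparable : ΔA m σ → ∀ {α β} → α ∈ σ → β ∈ σ → Comparable (rootPoint α) (rootPoint β)
  comparable anti {(i , j) , _} {(i′ , j′) , _} α∈ β∈
    with ℕ.<-≤-connex (toℕ i) (toℕ i′) | ℕ.<-≤-connex (toℕ j) (toℕ j′)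
  ... | inj₁ i<i′ | inj₁ j<j′ = inj₂ (inj₁ (j<j′ , s≤s i<i′))
  ... | inj₁ i<i′ | inj₂ j′≤j = inj₁ (sym (cong rootPoint (anti β∈ α∈ (ℕ.<⇒≤ i<i′ , j′≤j))))
  ... | inj₂ i′≤i | inj₁ j<j′ = inj₁ (cong rootPoint (anti α∈ β∈ (i′≤i , ℕ.<⇒≤ j<j′)))
  ... | inj₂ i′≤i | inj₂ j′≤j with ℕ.m≤n⇒m<n∨m≡n i′≤i | ℕ.m≤n⇒m<n∨m≡n j′≤j
  ...   | inj₁ i′<i | inj₁ j′<j = inj₂ (inj₂ (j′<j , s≤s i′<i))
  ...   | inj₁ i′<i | inj₂ j′≡j =
    inj₁ (cong rootPoint (anti α∈ β∈ (i′≤i , ℕ.≤-reflexive (sym j′≡j))))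
  ...   | inj₂ i′≡i | _ =
    inj₁ (sym (cong rootPoint (anti β∈ α∈ (ℕ.≤-reflexive (sym i′≡i) , j′≤j))))
  antichain : (∀ {α β} → α ∈ σ → β ∈ σ → Comparable (rootPoint α) (rootPoint β)) → ΔA m σ
  antichain cmp α∈ β∈ (i′≤i , j≤j′) with cmp α∈ β∈
  ... | inj₁ eq                     = rootPoint-injective eq
  ... | inj₂ (inj₁ (_ , s≤s i<i′)) = contradiction i′≤i (ℕ.<⇒≱ i<i′)
  ... | inj₂ (inj₂ (j′<j , _))     = contradiction j≤j′ (ℕ.<⇒≱ j′<j)

-- For semilength `suc m` the region is the triangle `1 ≤ y ≤ x ≤ m`, with one point for each
-- positive root of A_m. On both sides faces are tested by pairwise comparability of these points.
ΔDyck≅ΔA : ∀ m → ΔDyck 1 1 (suc m) ≅ ΔA m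
ΔDyck≅ΔA m = record
  { vertex-bijection = record
    { to = to
    ; from = from
    ; to-cong = λ {v} {v′} eq →
        rootPoint-injective (trans (to-point v) (trans (cong coord eq) (sym (to-point v′))))
    ; from-cong = cong (pos ∘ rootPoint)
    ; inverse = (λ {α} {v} v≡ →
          rootPoint-injective (trans (to-point v) (trans (cong coord v≡) (coord-pos (rootPoint (proj₁ α))))))
      , (λ {v} {α} α≡ →
          trans (cong (pos ∘ rootPoint) α≡) (trans (cong pos (to-point v)) (proj₂ (points⁻ (vertex∈points v)))))
    }
  ; preserves-faces = λ σ → mk⇔ (dyck⇒antichain σ) (antichain⇒dyck σ)
  }
  where
  open DyckChains 1 1 (suc m) ℕ.≤-refl

  DyckVertex RootVertex : Set
  DyckVertex = Setoid.Carrier (vertices (ΔDyck 1 1 (suc m)))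
  RootVertex = Setoid.Carrier (vertices (ΔA m))

  vertex∈points : ((v , _) : DyckVertex) → v ∈ points
  vertex∈points (v , face) = proj₁ (face⇒chain {[ v ]} face) (here refl)

  vertexRoot : (v : DyckVertex) → Σ[ α ∈ Root m ] rootPoint α ≡ coord (proj₁ v)
  vertexRoot v = region-root (proj₁ (points⁻ (vertex∈points v)))

  to : DyckVertex → RootVertex
  to v = proj₁ (vertexRoot v) , λ { (here refl) (here refl) _ → refl }

  to-point : ∀ v → rootPoint (proj₁ (to v)) ≡ coord (proj₁ v)
  to-point v = proj₂ (vertexRoot v)

  from : RootVertex → DyckVertex
  from (α , _) = pos (rootPoint α) , chain⇒face
    ( (λ { (here refl) → pos∈points (rootPoint-region α) })
    , λ { (here refl) (here refl) → inj₁ refl })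

  dyck⇒antichain : ∀ σ → ΔDyck 1 1 (suc m) (map proj₁ σ) → ΔA m (map (proj₁ ∘ to) σ)
  dyck⇒antichain σ face = Equivalence.from (antichain⇔comparable (map (proj₁ ∘ to) σ)) comparable
    where
    comparable : ∀ {α β} → α ∈ map (proj₁ ∘ to) σ → β ∈ map (proj₁ ∘ to) σ →
      Comparable (rootPoint α) (rootPoint β)
    comparable α∈ β∈ with u , u∈ , refl ← ∈-map⁻ (proj₁ ∘ to) α∈ | v , v∈ , refl ← ∈-map⁻ (proj₁ ∘ to) β∈ =
      subst₂ Comparable (sym (to-point u)) (sym (to-point v))
        (proj₂ (face⇒chain face) (∈-map⁺ proj₁ u∈) (∈-map⁺ proj₁ v∈))

  antichain⇒dyck : ∀ σ → ΔA m (map (proj₁ ∘ to) σ) → ΔDyck 1 1 (suc m) (map proj₁ σ)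
  antichain⇒dyck σ anti = chain⇒face (⊆points , comparable)
    where
    ⊆points : ∀ {p} → p ∈ map proj₁ σ → p ∈ points
    ⊆points p∈ with v , v∈ , refl ← ∈-map⁻ proj₁ p∈ = vertex∈points v
    comparable : ∀ {p q} → p ∈ map proj₁ σ → q ∈ map proj₁ σ → Comparable (coord p) (coord q)
    comparable p∈ q∈ with u , u∈ , refl ← ∈-map⁻ proj₁ p∈ | v , v∈ , refl ← ∈-map⁻ proj₁ q∈ =
      subst₂ Comparable (to-point u) (to-point v)
        (Equivalence.to (antichain⇔comparable (map (proj₁ ∘ to) σ)) anti (∈-map⁺ (proj₁ ∘ to) u∈) (∈-map⁺ (proj₁ ∘ to) v∈))

theorem1p2 : (∀ (a b : ℕ) → 1 ≤ a → 1 ≤ b → Coprime a b → ∀ (n : ℕ) → 1 ≤ n →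
    IsFiniteSimplicialComplex (ΔDyck a b n) × Shellable (ΔDyck a b n))
    ×
    (∀ (n : ℕ) → 1 ≤ n →
    IsFiniteSimplicialComplex (ΔDyck 1 1 n) × Shellable (ΔDyck 1 1 n) × (ΔDyck 1 1 n ≅ ΔA (n ∸ 1)))
theorem1p2 =
  (λ a b 1≤a _ _ n _ → let open DyckChains a b n 1≤a in isFiniteSimplicialComplex , shellable) ,
  λ { (suc m) _ → let open DyckChains 1 1 (suc m) ℕ.≤-refl in
      isFiniteSimplicialComplex , shellable , ΔDyck≅ΔA m }
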